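{- Let $(x,y,f)$ be an optimal solution to the reduced integer linear program described in the context for an instance of the multi-level Steiner tree problem. Then it yields an optimal multi-level Steiner tree: the edge sets $E_i=\{uv\in E \mid y_{uv}\ge i \text{ or } y_{vu}\ge i\}$, $1\le i\le\ell$, form a multi-level Steiner tree of minimum cost.
   Context: Multi-level Steiner tree (MLST) problem: an instance is a connected undirected graph $G=(V,E)$ with edge weights $c\colon E\to\mathbb{R}^+$ and nested terminal sets $T_\ell\subset\dots\subset T_1\subseteq V$. A multi-level Steiner tree consists of nested edge sets $E_\ell\subseteq\dots\subseteq E_1\subseteq E$ such that $E_i$ spans (connects) $T_i$ for all $1\le i\le \ell$. Its cost is $\sum_{i=1}^\ell \sum_{e\in E_i}c(e)$. Reduced ILP: replace each edge $uv\in E$ by the two directed edges $(u,v)$ and $(v,u)$, each of cost $c(u,v)=c(uv)$; let $A$ be the set of directed edges. Let $N(v)=\{u\in V\mid (u,v)\in A\}$, let $L(v)$ be the highest $i$ with $v\in T_i$ ($L(v)=0$ if $v\notin T_1$), and fix a source $s\in T_\ell$. The integer variables are $x_{uv},y_{uv},f_{uv}$ for each $(u,v)\in A$. Minimize $\sum_{uv\in E}c(u,v)(y_{uv}+y_{vu})$ subject to: - $\sum_{(v,w)\in A}f_{vw}-\sum_{(u,v)\in A}f_{uv}$ equals $|T_1|-1$ if $v=s$, $-1$ if $v\in T_1\setminus\{s\}$, and $0$ otherwise, for all $v\in V$; - $0\le f_{uv}\le(|T_1|-1)x_{uv}$ for all $(u,v)\in A$; - $\sum_{u\in N(v)}x_{uv}\le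 1$ for all $v\in V$; - $x_{uv}\le y_{uv}\le \ell x_{uv}$ for all $(u,v)\in A$; - $\sum_{u\in N(v)\setminus\{w\}}x_{uv}\ge x_{vw}$ for all $(v,w)\in A$ with $v\ne s$; - $\sum_{u\in N(v)\setminus\{w\}}y_{uv}\ge y_{vw}$ for all $(v,w)\in A$ with $v\ne s$; - $\sum_{u\in N(v)}y_{uv}\ge L(v)$ for all $v\in T_1\setminus\{s\}$; - $0\le x_{uv}\le 1$ for all $(u,v)\in A$. -}

module Defs where

open import Algebra.Bundles using (AbelianGroup; CommutativeMonoid)
open import Algebra.Core using (Op₁; Op₂)
open import Algebra.Structures using (IsAbelianGroup)
import Algebra.Definitions.RawMonoid as RawMonoidDefs
open import Data.Bool.Base using (if_then_else_)
open import Data.Fin.Base as Fin using (Fin; toℕ)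
import Data.Fin.Properties as Fin
open import Data.Fin.Subset using (Subset; _∈_; _⊂_; ∣_∣)
open import Data.Fin.Subset.Properties using (_∈?_)
open import Data.Integer.Base as ℤ using (ℤ; +_; -[1+_]; 0ℤ; 1ℤ; -1ℤ)
import Data.Integer.Properties as ℤ
open import Data.Nat.Base as ℕ using (ℕ; zero; suc)
open import Data.Product.Base using (_×_; _,_)
open import Data.Sum.Base using (_⊎_; swap)
open import Level using (0ℓ; _⊔_) renaming (suc to lsuc)
open import Relation.Binary.Construct.Closure.ReflexiveTransitive using (Star)
import Relation.Binary.Construct.NonStrictToStrict as NonStrictToStrict
open import Relation.Binary.Core using (Rel; _⇒_)
open import Relation.Binary.Definitions using (Decidable; Symmetric; Irreflexive)
open import Relation.Binary.PropositionalEquality.Core using (_≡_; _≢_)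
open import Relation.Binary.Structures using (IsPartialOrder)
open import Relation.Nullary.Decidable using (does; ¬?; _×-dec_; _⊎-dec_)
import Relation.Unary as Unary

-- The domain of the edge weights.  The real numbers with their usual addition
-- and order are an instance.  Weights are only ever added, compared and
-- multiplied by integers, so no further structure of ℝ is needed; the order is
-- not required to be total, so that constructive reals are covered as well.
record OrderedAbelianGroup (a ℓ₁ ℓ₂ : Level.Level) : Set (lsuc (a ⊔ ℓ₁ ⊔ ℓ₂)) where
  infix  4 _≈_ _≤_
  infixl 6 _+_
  infixr 7 _·_
  field
    Carrier        : Set a
    _≈_            : Rel Carrier ℓ₁
    _≤_            : Rel Carrier ℓ₂
    _+_            : Op₂ Carrier
    0#             : Carrier
    -_             : Op₁ Carrier
    isAbelianGroup : IsAbelianGroup _≈_ _+_ 0# -_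
    isPartialOrder : IsPartialOrder _≈_ _≤_
    +-mono-≤       : ∀ {w x y z} → w ≤ x → y ≤ z → (w + y) ≤ (x + z)

  abelianGroup : AbelianGroup a ℓ₁
  abelianGroup = record { isAbelianGroup = isAbelianGroup }

  open AbelianGroup abelianGroup public using (commutativeMonoid; rawMonoid)

  -- x < y means x ≤ y and not x ≈ y.
  open NonStrictToStrict _≈_ _≤_ public using (_<_)

  _·_ : ℤ → Carrier → Carrier
  (+ k)    · x = RawMonoidDefs._×_ rawMonoid k x
  -[1+ k ] · x = - RawMonoidDefs._×_ rawMonoid (suc k) x

module Sums {a ℓ} (M : CommutativeMonoid a ℓ) where
  open CommutativeMonoid M using (Carrier; ε; rawMonoid)
  open RawMonoidDefs rawMonoid public using (sum)

  sumOver : ∀ {n p} {P : Unary.Pred (Fin n) p} →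
            Unary.Decidable P → (Fin n → Carrier) → Carrier
  sumOver P? g = sum λ i → if does (P? i) then g i else ε

  -- Sum over the undirected edges of a symmetric irreflexive relation: each
  -- edge is counted once, through its orientation with u < v.
  sumEdges : ∀ {n p} {F : Rel (Fin n) p} →
             Decidable F → (Fin n → Fin n → Carrier) → Carrier
  sumEdges F? g = sum λ u → sumOver (λ v → (u Fin.<? v) ×-dec F? u v) (g u)

-- As a relation on the vertices, Adj contains both orientations of every
-- undirected edge; it therefore also serves as the set A of directed edges.
record ConnectedGraph (n : ℕ) : Set₁ where
  field
    Adj       : Rel (Fin n) 0ℓ
    adj?      : Decidable Adj
    symmetric : Symmetric Adj
    loopless  : Irreflexive _≡_ Adj
    connected : ∀ u v → Star Adj u v

record EdgeSet {n} (G : ConnectedGraph n) : Set₁ where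
  open ConnectedGraph G
  field
    Edge      : Rel (Fin n) 0ℓ
    edge?     : Decidable Edge
    symmetric : Symmetric Edge
    ⊆Adj      : Edge ⇒ Adj

-- Levels are the numbers 1, …, ℓ; values of T outside this range, and of c
-- outside the edges of the graph, play no role.
record Instance {a ℓ₁ ℓ₂} (K : OrderedAbelianGroup a ℓ₁ ℓ₂) (n ℓ : ℕ)
                : Set (lsuc 0ℓ ⊔ a ⊔ ℓ₁ ⊔ ℓ₂) where
  open OrderedAbelianGroup K
  field
    graph : ConnectedGraph n
  open ConnectedGraph graph public
  field
    c          : Fin n → Fin n → Carrier
    c-sym      : ∀ {u v} → Adj u v → c u v ≈ c v u
    c-positive : ∀ {u v} → Adj u v → 0# < c u v
    1≤ℓ        : 1 ℕ.≤ ℓ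
    T          : ℕ → Subset n
    T-nested   : ∀ {i} → 1 ℕ.≤ i → i ℕ.< ℓ → T (suc i) ⊂ T i

-- An integer point of the program; only the entries at directed edges of the
-- graph are variables, the others occur in no constraint and not in the
-- objective.
record Variables (n : ℕ) : Set where
  field
    x y f : Fin n → Fin n → ℤ

module _ {a ℓ₁ ℓ₂} {K : OrderedAbelianGroup a ℓ₁ ℓ₂} {n ℓ : ℕ}
         (I : Instance K n ℓ) where
  open OrderedAbelianGroup K using (Carrier; _≤_; _·_; commutativeMonoid)
  open Instance I
  open Sums ℤ.+-0-commutativeMonoid using () renaming (sumOver to sumOverℤ)
  open Sums commutativeMonoid using (sum; sumEdges)

  -- E i is the edge set of level i, for 1 ≤ i ≤ ℓ.
  record IsMultiLevelSteinerTree (E : ℕ → EdgeSet graph) : Set where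
    open EdgeSet
    field
      nested : ∀ {i} → 1 ℕ.≤ i → i ℕ.< ℓ → Edge (E (suc i)) ⇒ Edge (E i)
      spans  : ∀ {i} → 1 ℕ.≤ i → i ℕ.≤ ℓ →
               ∀ {u v} → u ∈ T i → v ∈ T i → Star (Edge (E i)) u v

  cost : (ℕ → EdgeSet graph) → Carrier
  cost E = sum λ (i : Fin ℓ) → sumEdges (EdgeSet.edge? (E (suc (toℕ i)))) c

  IsOptimalMultiLevelSteinerTree : (ℕ → EdgeSet graph) → Set (lsuc 0ℓ ⊔ ℓ₂)
  IsOptimalMultiLevelSteinerTree E =
    IsMultiLevelSteinerTree E ×
    (∀ E′ → IsMultiLevelSteinerTree E′ → cost E ≤ cost E′)

  -- The highest level i ≤ k with v ∈ T i, and 0 if there is none.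
  highestUpTo : ℕ → Fin n → ℕ
  highestUpTo zero    v = 0
  highestUpTo (suc k) v =
    if does (v ∈? T (suc k)) then suc k else highestUpTo k v

  L : Fin n → ℕ
  L = highestUpTo ℓ

  ∑N : Fin n → (Fin n → ℤ) → ℤ
  ∑N v = sumOverℤ (λ u → adj? u v)

  ∑N∖ : Fin n → Fin n → (Fin n → ℤ) → ℤ
  ∑N∖ v w = sumOverℤ (λ u → adj? u v ×-dec ¬? (u Fin.≟ w))

  ∑out : Fin n → (Fin n → ℤ) → ℤ
  ∑out v = sumOverℤ (λ w → adj? v w)

  ∣T₁∣-1 : ℤ
  ∣T₁∣-1 = (+ ∣ T 1 ∣) ℤ.- 1ℤ

  supply : (s v : Fin n) → ℤ
  supply s v =
    if does (v Fin.≟ s) then ∣T₁∣-1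
    else if does (v ∈? T 1) then -1ℤ
    else 0ℤ

  record IsFeasible (s : Fin n) (z : Variables n) : Set where
    open Variables z
    field
      flow       : ∀ v → ∑out v (λ w → f v w) ℤ.- ∑N v (λ u → f u v) ≡ supply s v
      f≥0        : ∀ {u v} → Adj u v → 0ℤ ℤ.≤ f u v
      f-capacity : ∀ {u v} → Adj u v → f u v ℤ.≤ ∣T₁∣-1 ℤ.* x u v
      indegree   : ∀ v → ∑N v (λ u → x u v) ℤ.≤ 1ℤ
      x≤y        : ∀ {u v} → Adj u v → x u v ℤ.≤ y u v
      y≤ℓx       : ∀ {u v} → Adj u v → y u v ℤ.≤ (+ ℓ) ℤ.* x u v
      x-incoming : ∀ {v w} → Adj v w → v ≢ s → ∑N∖ v w (λ u → x u v) ℤ.≥ x v w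
      y-incoming : ∀ {v w} → Adj v w → v ≢ s → ∑N∖ v w (λ u → y u v) ℤ.≥ y v w
      y-terminal : ∀ {v} → v ∈ T 1 → v ≢ s → ∑N v (λ u → y u v) ℤ.≥ + L v
      x≥0        : ∀ {u v} → Adj u v → 0ℤ ℤ.≤ x u v
      x≤1        : ∀ {u v} → Adj u v → x u v ℤ.≤ 1ℤ

  objective : Variables n → Carrier
  objective z = sumEdges adj? λ u v → (y u v ℤ.+ y v u) · c u v
    where open Variables z

  IsOptimal : Fin n → Variables n → Set ℓ₂
  IsOptimal s z =
    IsFeasible s z × (∀ z′ → IsFeasible s z′ → objective z ≤ objective z′)

  levelEdges : Variables n → ℕ → EdgeSet graph
  levelEdges z i = record
    { Edge      = λ u v → Adj u v × (y u v ℤ.≥ + i ⊎ y v u ℤ.≥ + i)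
    ; edge?     = λ u v → adj? u v ×-dec ((+ i ℤ.≤? y u v) ⊎-dec (+ i ℤ.≤? y v u))
    ; symmetric = λ (uv , h) → symmetric uv , swap h
    ; ⊆Adj      = λ (uv , _) → uv
    }
    where open Variables z

{-# OPTIONS --safe #-}

-- A solution of the program yields nested edge sets of no larger cost, because
-- an edge with values y_uv, y_vu lies in max(y_uv, y_vu) ≤ y_uv + y_vu levels.
-- They span the terminals: every vertex has at most one incoming arc with x = 1,
-- and following these arcs backwards from a terminal must lead to s, since the
-- vertices not leading to s receive no flow; y does not decrease on the way.
-- Conversely, a multi-level Steiner tree contains a tree rooted at s in which
-- the terminals of level i are joined to s by edges of level ≥ i: attach the
-- terminals level by level, from the highest level down.  Taking as y the level
-- at which a vertex was attached, and as f the sum of the unit flows along the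
-- tree paths to the terminals, gives a feasible solution of no larger objective.
module Submission where

open import Algebra.Bundles using (AbelianGroup)
open import Algebra.Properties.CommutativeMonoid.Sum as MonoidSum using ()
open import Algebra.Properties.Monoid.Mult as MonoidMult using ()
open import Data.Bool.Base using (true; false; if_then_else_)
open import Data.Fin.Base as Fin using (Fin; zero; suc; toℕ)
open import Data.Fin.Properties as Fin using (any?; pigeonhole)
open import Data.Fin.Subset using (Subset; _∈_; ∣_∣)
open import Data.Fin.Subset.Properties using (_∈?_)
open import Data.Integer.Base as ℤ using (ℤ; +_; 0ℤ; 1ℤ; -1ℤ; +≤+)
open import Data.Integer.Properties as ℤ using ()
open import Data.Integer.Solver using (module +-*-Solver)
open import Data.Nat.Base as ℕ using (ℕ; zero; suc; z≤n; s≤s; _≤‴_; ≤‴-reflexive; ≤‴-step)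
open import Data.Nat.GeneralisedArithmetic using (iterate)
open import Data.Nat.Properties as ℕ using ()
open import Data.Product.Base using (_×_; _,_; proj₁; proj₂; ∃)
open import Data.Sum.Base as Sum using (_⊎_; inj₁; inj₂)
open import Data.Vec.Base using ([]; _∷_)
open import Defs
open import Function.Base using (_∘_; const; id)
open import Level using (0ℓ)
open import Relation.Binary.Construct.Closure.ReflexiveTransitive using (Star; ε; _◅_; _◅◅_; reverse)
open import Relation.Binary.PropositionalEquality
  using (_≡_; _≢_; refl; sym; trans; cong; cong₂; subst; subst₂; module ≡-Reasoning)
open import Relation.Binary.Structures using (IsPartialOrder)
open import Relation.Nullary using (Dec; yes; no; ¬_; contradiction)
open import Relation.Nullary.Decidable using (does; ¬?; _×-dec_)
open import Relation.Unary using (Decidable)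

-- Conditionals on decidable propositions

-- Each branch receives the proof or the refutation. The explicit motive `C` singles out the
-- conditional to be resolved when a goal contains several.
if-elim : ∀ {p a c} {P : Set p} {A : Set a} (P? : Dec P) (C : A → Set c) {x y : A} →
          (P → C x) → (¬ P → C y) → C (if does P? then x else y)
if-elim (yes p) C t f = t p
if-elim (no ¬p) C t f = f ¬p

if-yes : ∀ {p a} {P : Set p} {A : Set a} (P? : Dec P) {x y : A} → P → (if does P? then x else y) ≡ x
if-yes P? {x} p = if-elim P? (_≡ x) (λ _ → refl) (contradiction p)

if-no : ∀ {p a} {P : Set p} {A : Set a} (P? : Dec P) {x y : A} → ¬ P → (if does P? then x else y) ≡ y
if-no P? {y = y} ¬p = if-elim P? (_≡ y) (λ p → contradiction p ¬p) (λ _ → refl)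

-- Finite sums in an ordered abelian group

module OrderedSums {a ℓ₁ ℓ₂} (K : OrderedAbelianGroup a ℓ₁ ℓ₂) where
  open OrderedAbelianGroup K
  open IsPartialOrder isPartialOrder public
    using (module Eq)
    renaming (refl to ≤-refl; trans to ≤-trans; reflexive to ≤-reflexive)
  open MonoidSum commutativeMonoid public
    using (sum; ∑-comm; ∑-distrib-+)
  open MonoidMult (AbelianGroup.monoid abelianGroup) public
    using (×-homo-+) renaming (_×_ to _⊗_)
  open AbelianGroup abelianGroup public using (identityˡ; identityʳ; ∙-cong)

  private variable
    m n : ℕ

  sum-mono : {g h : Fin n → Carrier} → (∀ i → g i ≤ h i) → sum g ≤ sum h
  sum-mono {zero}  g≤h = ≤-refl
  sum-mono {suc n} g≤h = +-mono-≤ (g≤h zero) (sum-mono (g≤h ∘ suc))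

  sum-cong : {g h : Fin n → Carrier} → (∀ i → g i ≈ h i) → sum g ≈ sum h
  sum-cong {g = g} {h} = MonoidSum.sum-cong-≋ commutativeMonoid {x = g} {h}

  sum-zero : {g : Fin n → Carrier} → (∀ i → g i ≈ 0#) → sum g ≈ 0#
  sum-zero {zero}  g≈0 = Eq.refl
  sum-zero {suc n} g≈0 = Eq.trans (∙-cong (g≈0 zero) (sum-zero (g≈0 ∘ suc))) (identityˡ 0#)

  sum-single : {g : Fin n → Carrier} (j : Fin n) → (∀ i → i ≢ j → g i ≈ 0#) → sum g ≈ g j
  sum-single zero    g≈0 =
    Eq.trans (∙-cong Eq.refl (sum-zero λ i → g≈0 (suc i) λ ())) (identityʳ _)
  sum-single (suc j) g≈0 =
    Eq.trans (∙-cong (g≈0 zero λ ()) (sum-single j λ i i≢j → g≈0 (suc i) (i≢j ∘ Fin.suc-injective)))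
             (identityˡ _)

  sum-nonneg : {g : Fin n → Carrier} → (∀ i → 0# ≤ g i) → 0# ≤ sum g
  sum-nonneg {n} 0≤g = ≤-trans (≤-reflexive (Eq.sym (sum-zero {n} λ _ → Eq.refl))) (sum-mono 0≤g)

  sum-indicator : ∀ (j : Fin n) c → sum (λ i → if does (i Fin.≟ j) then c else 0#) ≈ c
  sum-indicator j c = Eq.trans
    (sum-single j λ i i≢j → Eq.reflexive (if-no (i Fin.≟ j) i≢j))
    (Eq.reflexive (if-yes (j Fin.≟ j) refl))

  term≤sum : {g : Fin n → Carrier} → (∀ i → 0# ≤ g i) → ∀ j → g j ≤ sum g
  term≤sum {g = g} 0≤g j = ≤-trans (≤-reflexive (Eq.sym (sum-indicator j (g j)))) (sum-mono λ i →
    if-elim (i Fin.≟ j) (_≤ g i) (λ { refl → ≤-refl }) (λ _ → 0≤g i))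

  -- Index `i` stands for level `suc (toℕ i)`, so the condition selects the levels 1 to `k`; by
  -- `k ≤ m` none of them is cut off.
  sum-threshold : ∀ m {k} c → k ℕ.≤ m →
                  sum {m} (λ i → if does (toℕ i ℕ.<? k) then c else 0#) ≈ k ⊗ c
  sum-threshold m       c z≤n       = sum-zero {m} λ _ → Eq.refl
  sum-threshold (suc m) c (s≤s k≤m) = ∙-cong Eq.refl (sum-threshold m c k≤m)

  module _ {m p c} {D : Fin m → Set p} (D? : Decidable D) (0≤c : 0# ≤ c) where

    sum-threshold≤ : ∀ {k} → k ℕ.≤ m → (∀ i → toℕ i ℕ.< k → D i) →
                     k ⊗ c ≤ sum (λ i → if does (D? i) then c else 0#)
    sum-threshold≤ {k} k≤m <k⇒D =
      ≤-trans (≤-reflexive (Eq.sym (sum-threshold m c k≤m))) (sum-mono λ i →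
        if-elim (toℕ i ℕ.<? k) (_≤ (if does (D? i) then c else 0#))
          (λ i<k → if-elim (D? i) (c ≤_) (λ _ → ≤-refl) (contradiction (<k⇒D i i<k)))
          (λ _ → if-elim (D? i) (0# ≤_) (λ _ → 0≤c) (λ _ → ≤-refl)))

    -- In the application `D` says that an edge lies in a level, and `k` and `l` are the values of
    -- `y` on its two orientations. The indicator of a union is at most the sum of the indicators.
    sum≤threshold+threshold : ∀ {k l} → k ℕ.≤ m → l ℕ.≤ m →
      (∀ i → D i → toℕ i ℕ.< k ⊎ toℕ i ℕ.< l) →
      sum (λ i → if does (D? i) then c else 0#) ≤ (k ℕ.+ l) ⊗ c
    sum≤threshold+threshold {k} {l} k≤m l≤m D⇒< =
      ≤-trans (sum-mono λ i → if-elim (D? i) (_≤ below k i + below l i) (covered i ∘ D⇒< i) (λ _ → 0≤0+0 i))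
        (≤-reflexive (Eq.trans (∑-distrib-+ (below k) (below l))
          (Eq.trans (∙-cong (sum-threshold m c k≤m) (sum-threshold m c l≤m))
            (Eq.sym (×-homo-+ c k l)))))
      where
      below : ℕ → Fin m → Carrier
      below k i = if does (toℕ i ℕ.<? k) then c else 0#

      0≤below : ∀ k i → 0# ≤ below k i
      0≤below k i = if-elim (toℕ i ℕ.<? k) (0# ≤_) (λ _ → 0≤c) (λ _ → ≤-refl)

      c≤below : ∀ k i → toℕ i ℕ.< k → c ≤ below k i
      c≤below k i i<k = if-elim (toℕ i ℕ.<? k) (c ≤_) (λ _ → ≤-refl) (contradiction i<k)

      0≤0+0 : ∀ i → 0# ≤ below k i + below l i
      0≤0+0 i = ≤-trans (≤-reflexive (Eq.sym (identityˡ 0#))) (+-mono-≤ (0≤below k i) (0≤below l i))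

      covered : ∀ i → toℕ i ℕ.< k ⊎ toℕ i ℕ.< l → c ≤ below k i + below l i
      covered i (inj₁ i<k) =
        ≤-trans (≤-reflexive (Eq.sym (identityʳ c))) (+-mono-≤ (c≤below k i i<k) (0≤below l i))
      covered i (inj₂ i<l) =
        ≤-trans (≤-reflexive (Eq.sym (identityˡ c))) (+-mono-≤ (0≤below k i) (c≤below l i i<l))

-- Integer sums, nested families and iterated maps

ℤ-orderedAbelianGroup : OrderedAbelianGroup 0ℓ 0ℓ 0ℓ
ℤ-orderedAbelianGroup = record
  { isAbelianGroup = ℤ.+-0-isAbelianGroup
  ; isPartialOrder = ℤ.≤-isPartialOrder
  ; +-mono-≤       = ℤ.+-mono-≤
  }

module ℤΣ = OrderedSums ℤ-orderedAbelianGroup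

sum-minus : ∀ {n} (g h : Fin n → ℤ) → ℤΣ.sum (λ i → g i ℤ.- h i) ≡ ℤΣ.sum g ℤ.- ℤΣ.sum h
sum-minus {zero}  g h = refl
sum-minus {suc n} g h = begin
  (g zero ℤ.- h zero) ℤ.+ ℤΣ.sum (λ i → g (suc i) ℤ.- h (suc i))
    ≡⟨ cong (λ z → (g zero ℤ.- h zero) ℤ.+ z) (sum-minus (g ∘ suc) (h ∘ suc)) ⟩
  (g zero ℤ.- h zero) ℤ.+ (ℤΣ.sum (g ∘ suc) ℤ.- ℤΣ.sum (h ∘ suc))
    ≡⟨ solve 4 (λ a b c d → (a :- b) :+ (c :- d) := (a :+ c) :- (b :+ d)) refl
         (g zero) (h zero) (ℤΣ.sum (g ∘ suc)) (ℤΣ.sum (h ∘ suc)) ⟩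
  (g zero ℤ.+ ℤΣ.sum (g ∘ suc)) ℤ.- (h zero ℤ.+ ℤΣ.sum (h ∘ suc)) ∎
  where
  open ≡-Reasoning
  open +-*-Solver using (solve; _:+_; _:-_; _:=_)

-- Serves both the terminal sets and the edge sets. Recursion on `≤‴` raises the lower end, so every
-- step stays in the range where nesting is assumed.
antitone : ∀ {p ℓ} {P : ℕ → Set p} → (∀ {i} → 1 ℕ.≤ i → i ℕ.< ℓ → P (suc i) → P i) →
           ∀ {i j} → 1 ℕ.≤ i → i ℕ.≤ j → j ℕ.≤ ℓ → P j → P i
antitone {ℓ = ℓ} {P} step 1≤i i≤j = go 1≤i (ℕ.≤⇒≤‴ i≤j)
  where
  go : ∀ {i j} → 1 ℕ.≤ i → i ≤‴ j → j ℕ.≤ ℓ → P j → P i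
  go 1≤i (≤‴-reflexive refl) j≤ℓ Pj = Pj
  go 1≤i (≤‴-step i<j)       j≤ℓ Pj =
    step 1≤i (ℕ.≤-trans (ℕ.≤‴⇒≤ i<j) j≤ℓ) (go (ℕ.m≤n⇒m≤1+n 1≤i) i<j j≤ℓ Pj)

sum-membership : ∀ {n} (p : Subset n) →
                 ℤΣ.sum (λ i → if does (i ∈? p) then 1ℤ else 0ℤ) ≡ + ∣ p ∣
sum-membership []          = refl
sum-membership (true ∷ p)  = cong (λ z → 1ℤ ℤ.+ z) (sum-membership p)
sum-membership (false ∷ p) = trans (ℤ.+-identityˡ _) (sum-membership p)

iterate-+ : ∀ {a} {A : Set a} (g : A → A) x k l →
            iterate g x (k ℕ.+ l) ≡ iterate g (iterate g x k) l
iterate-+ g x zero    l = refl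
iterate-+ g x (suc k) l = iterate-+ g (g x) k l

-- By the pigeonhole principle the orbit revisits a point within n steps, and
-- the detour can be cut out.
iterate-shorten : ∀ {n} (g : Fin n → Fin n) x {y} → iterate g x (suc n) ≡ y →
                  ∃ λ k → k ℕ.< suc n × iterate g x k ≡ y
iterate-shorten {n} g x {y} eq
  with i , j , i<j , gi≡gj ← pigeonhole (ℕ.n<1+n n) (λ (i : Fin (suc n)) → iterate g x (toℕ i))
  = toℕ i ℕ.+ rest , shorter , (begin
    iterate g x (toℕ i ℕ.+ rest)           ≡⟨ iterate-+ g x (toℕ i) rest ⟩
    iterate g (iterate g x (toℕ i)) rest   ≡⟨ cong (λ z → iterate g z rest) gi≡gj ⟩
    iterate g (iterate g x (toℕ j)) rest   ≡⟨ iterate-+ g x (toℕ j) rest ⟨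
    iterate g x (toℕ j ℕ.+ rest)           ≡⟨ cong (iterate g x) j+rest ⟩
    iterate g x (suc n)                    ≡⟨ eq ⟩
    y                                      ∎)
  where
  open ≡-Reasoning
  rest : ℕ
  rest = suc n ℕ.∸ toℕ j
  j+rest : toℕ j ℕ.+ rest ≡ suc n
  j+rest = ℕ.m+[n∸m]≡n (ℕ.<⇒≤ (Fin.toℕ<n j))
  shorter : toℕ i ℕ.+ rest ℕ.< suc n
  shorter = subst (toℕ i ℕ.+ rest ℕ.<_) j+rest (ℕ.+-monoˡ-< rest i<j)

-- Flow inside `C` cancels when the net outflows are added. Restricting `g` to `inner` preserves the
-- inflow of each vertex of `C`, since nothing enters `C` from outside, and can only reduce its
-- outflow.
net-outflow≥0 : ∀ {n p} {C : Fin n → Set p} (C? : Decidable C) (g : Fin n → Fin n → ℤ) →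
                (∀ u w → 0ℤ ℤ.≤ g u w) → (∀ u w → C w → ¬ C u → g u w ≡ 0ℤ) →
                0ℤ ℤ.≤ ℤΣ.sum (λ w → if does (C? w) then ℤΣ.sum (g w) ℤ.- ℤΣ.sum (λ u → g u w) else 0ℤ)
net-outflow≥0 {n} {C = C} C? g 0≤g closed = ℤ.≤-trans (ℤ.≤-reflexive (sym inner≡0)) (ℤΣ.sum-mono inner≤)
  where
  inner : Fin n → Fin n → ℤ
  inner u w = if does (C? u) then (if does (C? w) then g u w else 0ℤ) else 0ℤ

  inner≤g : ∀ u w → inner u w ℤ.≤ g u w
  inner≤g u w = if-elim (C? u) (ℤ._≤ g u w)
    (λ _ → if-elim (C? w) (ℤ._≤ g u w) (λ _ → ℤ.≤-refl) (λ _ → 0≤g u w)) (λ _ → 0≤g u w)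

  g≤inner : ∀ u w → C w → g u w ℤ.≤ inner u w
  g≤inner u w Cw = if-elim (C? u) (g u w ℤ.≤_)
    (λ _ → if-elim (C? w) (g u w ℤ.≤_) (λ _ → ℤ.≤-refl) (contradiction Cw))
    (λ ¬Cu → ℤ.≤-reflexive (closed u w Cw ¬Cu))

  net : Fin n → ℤ
  net w = ℤΣ.sum (inner w) ℤ.- ℤΣ.sum (λ u → inner u w)

  inner≤ : ∀ w → net w ℤ.≤ (if does (C? w) then ℤΣ.sum (g w) ℤ.- ℤΣ.sum (λ u → g u w) else 0ℤ)
  inner≤ w = if-elim (C? w) (net w ℤ.≤_)
    (λ Cw → ℤ.+-mono-≤ (ℤΣ.sum-mono (inner≤g w)) (ℤ.neg-mono-≤ (ℤΣ.sum-mono λ u → g≤inner u w Cw)))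
    (λ ¬Cw → ℤ.≤-reflexive (cong₂ ℤ._-_
      (ℤΣ.sum-zero {g = inner w} λ u → if-no (C? w) ¬Cw)
      (ℤΣ.sum-zero {g = λ u → inner u w} λ u →
        if-elim (C? u) (_≡ 0ℤ) (λ _ → if-no (C? w) ¬Cw) (λ _ → refl))))

  inner≡0 : ℤΣ.sum net ≡ 0ℤ
  inner≡0 = begin
    ℤΣ.sum net
      ≡⟨ sum-minus (λ w → ℤΣ.sum (inner w)) (λ w → ℤΣ.sum (λ u → inner u w)) ⟩
    ℤΣ.sum (λ w → ℤΣ.sum (inner w)) ℤ.- ℤΣ.sum (λ w → ℤΣ.sum (λ u → inner u w))
      ≡⟨ ℤ.i≡j⇒i-j≡0 (ℤΣ.∑-comm inner) ⟩
    0ℤ ∎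
    where open ≡-Reasoning

-- Terminal sets and highest levels

module _ {a ℓ₁ ℓ₂} {K : OrderedAbelianGroup a ℓ₁ ℓ₂} {n ℓ : ℕ} (I : Instance K n ℓ) where
  open Instance I

  T-antitone : ∀ {v i j} → 1 ℕ.≤ i → i ℕ.≤ j → j ℕ.≤ ℓ → v ∈ T j → v ∈ T i
  T-antitone {v} = antitone {P = λ i → v ∈ T i} λ 1≤i i<ℓ → proj₁ (T-nested 1≤i i<ℓ)

  highestUpTo-upper : ∀ {v i} k → 1 ℕ.≤ i → i ℕ.≤ k → v ∈ T i → i ℕ.≤ highestUpTo I k v
  highestUpTo-upper         zero    1≤i i≤0   _   = i≤0
  highestUpTo-upper {v} {i} (suc k) 1≤i i≤1+k v∈T =
    if-elim (v ∈? T (suc k)) (i ℕ.≤_) (λ _ → i≤1+k) λ v∉T →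
      highestUpTo-upper k 1≤i (ℕ.≤-pred (ℕ.≤∧≢⇒< i≤1+k λ { refl → v∉T v∈T })) v∈T

  highestUpTo-least : ∀ {v} k j → (∀ {i} → 1 ℕ.≤ i → i ℕ.≤ k → v ∈ T i → i ℕ.≤ j) →
                      highestUpTo I k v ℕ.≤ j
  highestUpTo-least     zero    j bound = z≤n
  highestUpTo-least {v} (suc k) j bound =
    if-elim (v ∈? T (suc k)) (ℕ._≤ j) (bound (s≤s z≤n) ℕ.≤-refl)
      (λ _ → highestUpTo-least k j λ 1≤i i≤k → bound 1≤i (ℕ.m≤n⇒m≤1+n i≤k))

  -- From a feasible point to a multi-level Steiner tree

  module Feasible {s : Fin n} (z : Variables n) (feasible : IsFeasible I s z) where
    open Variables z
    open IsFeasible feasible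

    -- The default `w` makes the iteration stall at a vertex without incoming arc, so that it
    -- reaches `s` from there only if that vertex is `s`.
    pred : Fin n → Fin n
    pred w with any? (λ u → adj? u w ×-dec (1ℤ ℤ.≤? x u w))
    ... | yes (u , _) = u
    ... | no _        = w

    -- Two distinct tails would bring the sum of `x` over the arcs into `w` to at least 2, against
    -- `indegree`.
    x≥1⇒pred : ∀ {u w} → Adj u w → 1ℤ ℤ.≤ x u w → u ≡ pred w
    x≥1⇒pred {u} {w} uw 1≤x with any? (λ u → adj? u w ×-dec (1ℤ ℤ.≤? x u w))
    ... | no none               = contradiction (u , uw , 1≤x) none
    ... | yes (u′ , u′w , 1≤x′) with u Fin.≟ u′
    ...   | yes u≡u′ = u≡u′
    ...   | no  u≢u′ = contradiction (ℤ.≤-trans 2≤indegree (indegree w)) λ { (+≤+ (s≤s ())) }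
      where
      δ : Fin n → Fin n → ℤ
      δ u i = if does (i Fin.≟ u) then 1ℤ else 0ℤ

      δ+δ≤x : ∀ i → δ u i ℤ.+ δ u′ i ℤ.≤ (if does (adj? i w) then x i w else 0ℤ)
      δ+δ≤x i with i Fin.≟ u | i Fin.≟ u′ | adj? i w
      ... | yes refl | yes refl | _      = contradiction refl u≢u′
      ... | yes refl | no _     | yes _  = 1≤x
      ... | yes refl | no _     | no ¬iw = contradiction uw ¬iw
      ... | no _     | yes refl | yes _  = 1≤x′
      ... | no _     | yes refl | no ¬iw = contradiction u′w ¬iw
      ... | no _     | no _     | yes iw = x≥0 iw
      ... | no _     | no _     | no _   = ℤ.≤-refl

      2≤indegree : + 2 ℤ.≤ ∑N I w (λ u → x u w)
      2≤indegree = ℤ.≤-trans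
        (ℤ.≤-reflexive (sym (trans (ℤΣ.∑-distrib-+ (δ u) (δ u′))
          (cong₂ ℤ._+_ (ℤΣ.sum-indicator u 1ℤ) (ℤΣ.sum-indicator u′ 1ℤ)))))
        (ℤΣ.sum-mono δ+δ≤x)

    -- Integrality enters here: a nonnegative `x u w` other than 0 is at least 1.
    x-off-pred : ∀ {u w} → Adj u w → u ≢ pred w → x u w ≡ 0ℤ
    x-off-pred {u} {w} uw u≢pred with x u w in eq | x≥0 uw
    ... | + zero    | _ = refl
    ... | + (suc k) | _ =
      contradiction (x≥1⇒pred uw (subst (1ℤ ℤ.≤_) (sym eq) (+≤+ (s≤s z≤n)))) u≢pred

    y-off-pred : ∀ {u w} → Adj u w → u ≢ pred w → y u w ≡ 0ℤ
    y-off-pred {u} {w} uw u≢pred = ℤ.≤-antisym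
      (subst (y u w ℤ.≤_) (trans (cong (λ i → (+ ℓ) ℤ.* i) x≡0) (ℤ.*-zeroʳ (+ ℓ))) (y≤ℓx uw))
      (subst (ℤ._≤ y u w) x≡0 (x≤y uw))
      where
      x≡0 : x u w ≡ 0ℤ
      x≡0 = x-off-pred uw u≢pred

    f-off-pred : ∀ {u w} → Adj u w → u ≢ pred w → f u w ≡ 0ℤ
    f-off-pred {u} {w} uw u≢pred = ℤ.≤-antisym
      (subst (f u w ℤ.≤_) (trans (cong (λ i → ∣T₁∣-1 I ℤ.* i) (x-off-pred uw u≢pred)) (ℤ.*-zeroʳ (∣T₁∣-1 I)))
        (f-capacity uw))
      (f≥0 uw)

    -- All terms but that of `pred w` vanish, so this one term carries the whole sum; as `k` is
    -- positive, `pred w` cannot be excluded by `P`. The predicate `P` allows for sums over all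
    -- neighbours and for sums omitting one.
    from-pred : ∀ {w k p} {P : Fin n → Set p} (P? : Decidable P) → (∀ {u} → P u → Adj u w) →
                1ℤ ℤ.≤ k → k ℤ.≤ ℤΣ.sum (λ u → if does (P? u) then y u w else 0ℤ) →
                P (pred w) × k ℤ.≤ y (pred w) w
    from-pred {w} {k} P? P⇒Adj 1≤k k≤sum with P? (pred w) | subst (k ℤ.≤_) (ℤΣ.sum-single (pred w)
      λ u u≢pred → if-elim (P? u) (_≡ 0ℤ) (λ Pu → y-off-pred (P⇒Adj Pu) u≢pred) (λ _ → refl)) k≤sum
    ... | yes Pu | k≤y = Pu , k≤y
    ... | no  _  | k≤0 = contradiction (ℤ.≤-trans 1≤k k≤0) λ { (+≤+ ()) }

    -- The bound on `k` makes the property decidable by search; `iterate-shorten` restores the bound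
    -- when a step is added.
    Rooted : Fin n → Set
    Rooted v = ∃ λ k → k ℕ.< suc n × iterate pred v k ≡ s

    rooted? : Decidable Rooted
    rooted? v = ℕ.anyUpTo? (λ k → iterate pred v k Fin.≟ s) (suc n)

    rooted-pred : ∀ {w} → Rooted (pred w) → Rooted w
    rooted-pred {w} (k , s≤s k≤n , eq) with k ℕ.≟ n
    ... | no  k≢n  = suc k , s≤s (ℕ.≤∧≢⇒< k≤n k≢n) , eq
    -- One more step would break the bound, so a detour is cut out of the orbit.
    ... | yes refl = iterate-shorten pred w eq

    -- The vertices that are not rooted are closed under pred, so no flow enters
    -- them, while a terminal among them would consume a unit of flow.
    terminal-rooted : ∀ {v} → v ∈ T 1 → Rooted v
    terminal-rooted {v} v∈T with rooted? v
    ... | yes rooted  = rooted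
    ... | no unrooted = contradiction (ℤ.≤-trans 0≤supply supply≤-1) λ ()
      where
      unrooted? : Decidable (¬_ ∘ Rooted)
      unrooted? w = ¬? (rooted? w)

      g : Fin n → Fin n → ℤ
      g u w = if does (adj? u w) then f u w else 0ℤ

      closed : ∀ u w → ¬ Rooted w → ¬ ¬ Rooted u → g u w ≡ 0ℤ
      closed u w ¬rw ¬¬ru = if-elim (adj? u w) (_≡ 0ℤ)
        (λ uw → f-off-pred uw λ { refl → ¬¬ru (¬rw ∘ rooted-pred) }) (λ _ → refl)

      consumed : Fin n → ℤ
      consumed w = if does (w Fin.≟ v) then -1ℤ else 0ℤ

      0≤supply : 0ℤ ℤ.≤ ℤΣ.sum (λ w → if does (unrooted? w) then supply I s w else 0ℤ)
      0≤supply = ℤ.≤-trans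
        (net-outflow≥0 unrooted? g
          (λ u w → if-elim (adj? u w) (0ℤ ℤ.≤_) f≥0 (λ _ → ℤ.≤-refl)) closed)
        (ℤΣ.sum-mono λ w → ℤ.≤-reflexive (cong (λ i → if does (unrooted? w) then i else 0ℤ) (flow w)))

      s-rooted : Rooted s
      s-rooted = 0 , s≤s z≤n , refl

      -- Only `s` can have positive supply, and `s` is rooted.
      supply≤consumed : ∀ w → (if does (unrooted? w) then supply I s w else 0ℤ) ℤ.≤ consumed w
      supply≤consumed w = if-elim (w Fin.≟ v)
        ((if does (unrooted? w) then supply I s w else 0ℤ) ℤ.≤_)
        (λ { refl → if-elim (unrooted? v) (ℤ._≤ -1ℤ)
               (λ ¬rv → if-elim (v Fin.≟ s) (ℤ._≤ -1ℤ)
                 (λ { refl → contradiction s-rooted ¬rv })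
                 (λ _ → if-elim (v ∈? T 1) (ℤ._≤ -1ℤ) (λ _ → ℤ.≤-refl) (contradiction v∈T)))
               (contradiction unrooted) })
        (λ _ → if-elim (unrooted? w) (ℤ._≤ 0ℤ)
          (λ ¬rw → if-elim (w Fin.≟ s) (ℤ._≤ 0ℤ)
            (λ { refl → contradiction s-rooted ¬rw })
            (λ _ → if-elim (w ∈? T 1) (ℤ._≤ 0ℤ) (λ _ → ℤ.-≤+) (λ _ → ℤ.≤-refl)))
          (λ _ → ℤ.≤-refl))

      supply≤-1 : ℤΣ.sum (λ w → if does (unrooted? w) then supply I s w else 0ℤ) ℤ.≤ -1ℤ
      supply≤-1 = ℤ.≤-trans (ℤΣ.sum-mono supply≤consumed) (ℤ.≤-reflexive (ℤΣ.sum-indicator v -1ℤ))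

    module _ {i : ℕ} (1≤i : 1 ℕ.≤ i) where
      open EdgeSet (levelEdges I z i) using (Edge; symmetric)

      Incoming : Fin n → Set
      Incoming w = Adj (pred w) w × + i ℤ.≤ y (pred w) w

      -- `y-incoming` for the arc from `pred w` to `w` bounds the values entering `pred w` from
      -- below, and by `from-pred` a single arc carries them.
      incoming-pred : ∀ {w} → pred w ≢ s → Incoming w → Incoming (pred w)
      incoming-pred {w} pred≢s (uw , i≤y)
        with (pu , _) , y≤y′ ← from-pred (λ u → adj? u (pred w) ×-dec ¬? (u Fin.≟ w)) proj₁
                                 (ℤ.≤-trans (+≤+ 1≤i) i≤y) (y-incoming uw pred≢s)
        = pu , ℤ.≤-trans i≤y y≤y′

      path-from-root : ∀ k w → w ≡ s ⊎ Incoming w → iterate pred w k ≡ s → Star Edge s w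
      path-from-root zero    w _ refl = ε
      -- The orbit may meet `s` early; the path ends there, since `Incoming` is not propagated past
      -- `s`.
      path-from-root (suc k) w (inj₁ refl) eq = ε
      path-from-root (suc k) w (inj₂ inc@(uw , i≤y)) eq =
        path-from-root k (pred w) above eq ◅◅ (uw , inj₁ i≤y) ◅ ε
        where
        above : pred w ≡ s ⊎ Incoming (pred w)
        above with pred w Fin.≟ s
        ... | yes eq = inj₁ eq
        ... | no neq = inj₂ (incoming-pred neq inc)

      -- `terminal-rooted` supplies the number of steps back to `s`, and `y-terminal` with `i ≤ L v`
      -- supplies the value on the last arc.
      root-to-terminal : i ℕ.≤ ℓ → ∀ {v} → v ∈ T i → Star Edge s v
      root-to-terminal i≤ℓ {v} v∈T with v Fin.≟ s
      ... | yes refl = ε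
      ... | no  v≢s
        with k , _ , eq ← terminal-rooted (T-antitone ℕ.≤-refl 1≤i i≤ℓ v∈T)
        with uv , L≤y ← from-pred (λ u → adj? u v) id
               (+≤+ (ℕ.≤-trans 1≤i (highestUpTo-upper ℓ 1≤i i≤ℓ v∈T)))
               (y-terminal (T-antitone ℕ.≤-refl 1≤i i≤ℓ v∈T) v≢s)
        = path-from-root k v (inj₂ (uv , ℤ.≤-trans (+≤+ (highestUpTo-upper ℓ 1≤i i≤ℓ v∈T)) L≤y)) eq

    levelEdges-isMultiLevelSteinerTree : IsMultiLevelSteinerTree I (levelEdges I z)
    levelEdges-isMultiLevelSteinerTree = record
      { nested = λ { {i} _ _ (uv , inj₁ 1+i≤y) → uv , inj₁ (ℤ.≤-trans (+≤+ (ℕ.n≤1+n i)) 1+i≤y)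
                   ; {i} _ _ (uv , inj₂ 1+i≤y) → uv , inj₂ (ℤ.≤-trans (+≤+ (ℕ.n≤1+n i)) 1+i≤y) }
      ; spans  = λ {i} 1≤i i≤ℓ u∈T v∈T →
          reverse (EdgeSet.symmetric (levelEdges I z i)) (root-to-terminal 1≤i i≤ℓ u∈T)
            ◅◅ root-to-terminal 1≤i i≤ℓ v∈T
      }

  -- Growing a rooted tree inside a multi-level Steiner tree

  module _ (E : ℕ → EdgeSet graph) (mlst : IsMultiLevelSteinerTree I E) (s : Fin n) where
    open EdgeSet
    open IsMultiLevelSteinerTree mlst

    -- A tree grown from s; lev v is the level at which v was attached to its
    -- parent, and 0 if v has not been attached.
    record Tree (i : ℕ) : Set where
      field
        par       : Fin n → Fin n
        lev rank  : Fin n → ℕ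
        lev-root  : lev s ≡ ℓ
        lev-lower : ∀ {v} → 1 ℕ.≤ lev v → i ℕ.≤ lev v
        lev≤ℓ     : ∀ v → lev v ℕ.≤ ℓ
        par-edge  : ∀ {v} → v ≢ s → 1 ℕ.≤ lev v → Edge (E (lev v)) (par v) v
        par-lev   : ∀ {v} → v ≢ s → 1 ℕ.≤ lev v → lev v ℕ.≤ lev (par v)
        par-rank  : ∀ {v} → v ≢ s → 1 ℕ.≤ lev v → rank (par v) ℕ.< rank v
    open Tree

    _⊑_ : ∀ {i j} → Tree i → Tree j → Set
    t ⊑ t′ = ∀ v → lev t v ℕ.≤ lev t′ v

    -- The root counts as attached at the top level, so paths can start from it at every stage.
    root-tree : Tree ℓ
    root-tree = record
      { par       = id
      ; lev       = lev₀
      ; rank      = const 0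
      ; lev-root  = if-yes (s Fin.≟ s) refl
      ; lev-lower = λ {v} → if-elim (v Fin.≟ s) (λ k → 1 ℕ.≤ k → ℓ ℕ.≤ k) (λ _ _ → ℕ.≤-refl) (λ _ ())
      ; lev≤ℓ     = λ v → if-elim (v Fin.≟ s) (ℕ._≤ ℓ) (λ _ → ℕ.≤-refl) (λ _ → z≤n)
      ; par-edge  = λ v≢s 1≤lev → contradiction 1≤lev (unattached v≢s)
      ; par-lev   = λ v≢s 1≤lev → contradiction 1≤lev (unattached v≢s)
      ; par-rank  = λ v≢s 1≤lev → contradiction 1≤lev (unattached v≢s)
      }
      where
      lev₀ : Fin n → ℕ
      lev₀ v = if does (v Fin.≟ s) then ℓ else 0

      unattached : ∀ {v} → v ≢ s → ¬ 1 ℕ.≤ lev₀ v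
      unattached {v} v≢s = if-elim (v Fin.≟ s) (λ k → ¬ 1 ℕ.≤ k) (λ v≡s → contradiction v≡s v≢s) (λ _ ())

    lower : ∀ {i} → Tree (suc i) → Tree i
    lower t = record
      { Tree t
      ; lev-lower = λ 1≤lev → ℕ.<⇒≤ (lev-lower t 1≤lev)
      }

    module _ {i} (1≤i : 1 ℕ.≤ i) (i≤ℓ : i ℕ.≤ ℓ) where

      -- The new leaf `w` gets level `i`, which by `lev-lower` is at most the level of `u`. Parents
      -- of attached vertices are attached, hence different from `w`, so their ranks do not change.
      attach : (t : Tree i) {u w : Fin n} → 1 ℕ.≤ lev t u → ¬ 1 ℕ.≤ lev t w → Edge (E i) u w →
               ∃ λ (t′ : Tree i) → t ⊑ t′ × 1 ℕ.≤ lev t′ w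
      attach t {u} {w} 1≤u 1≰w uw = t′ , lev≤lev′ , subst (1 ℕ.≤_) (sym (if-yes (w Fin.≟ w) refl)) 1≤i
        where
        par′ : Fin n → Fin n
        par′ v = if does (v Fin.≟ w) then u else par t v

        lev′ rank′ : Fin n → ℕ
        lev′ v = if does (v Fin.≟ w) then i else lev t v
        rank′ v = if does (v Fin.≟ w) then suc (rank t u) else rank t v

        lev≤lev′ : ∀ v → lev t v ℕ.≤ lev′ v
        lev≤lev′ v = if-elim (v Fin.≟ w) (lev t v ℕ.≤_)
          (λ { refl → ℕ.≤-trans (ℕ.≤-pred (ℕ.≰⇒> 1≰w)) z≤n }) (λ _ → ℕ.≤-refl)

        attached≢w : ∀ {v} → 1 ℕ.≤ lev t v → v ≢ w
        attached≢w 1≤v refl = 1≰w 1≤v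

        rank′≡rank : ∀ {v} → 1 ℕ.≤ lev t v → rank′ v ≡ rank t v
        rank′≡rank {v} 1≤v = if-no (v Fin.≟ w) (attached≢w 1≤v)

        lower′ : ∀ {v} → 1 ℕ.≤ lev′ v → i ℕ.≤ lev′ v
        lower′ {v} = if-elim (v Fin.≟ w) (λ k → 1 ℕ.≤ k → i ℕ.≤ k) (λ _ _ → ℕ.≤-refl) (λ _ → lev-lower t)

        edge′ : ∀ {v} → v ≢ s → 1 ℕ.≤ lev′ v → Edge (E (lev′ v)) (par′ v) v
        edge′ {v} v≢s 1≤v with v Fin.≟ w
        ... | yes refl = uw
        ... | no _     = par-edge t v≢s 1≤v

        par-lev′ : ∀ {v} → v ≢ s → 1 ℕ.≤ lev′ v → lev′ v ℕ.≤ lev′ (par′ v)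
        par-lev′ {v} v≢s 1≤v with v Fin.≟ w
        ... | yes refl = ℕ.≤-trans (lev-lower t 1≤u) (lev≤lev′ u)
        ... | no _     = ℕ.≤-trans (par-lev t v≢s 1≤v) (lev≤lev′ (par t v))

        par-rank′ : ∀ {v} → v ≢ s → 1 ℕ.≤ lev′ v → rank′ (par′ v) ℕ.< rank′ v
        par-rank′ {v} v≢s 1≤v with v Fin.≟ w
        ... | yes refl = s≤s (ℕ.≤-reflexive (rank′≡rank 1≤u))
        ... | no _     = subst (ℕ._< rank t v) (sym (rank′≡rank (ℕ.≤-trans 1≤v (par-lev t v≢s 1≤v))))
                           (par-rank t v≢s 1≤v)

        t′ : Tree i
        t′ = record
          { par       = par′
          ; lev       = lev′
          ; rank      = rank′
          ; lev-root  = trans (if-no (s Fin.≟ w) (attached≢w (subst (1 ℕ.≤_) (sym (lev-root t)) 1≤ℓ))) (lev-root t)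
          ; lev-lower = lower′
          ; lev≤ℓ     = λ v → if-elim (v Fin.≟ w) (ℕ._≤ ℓ) (λ _ → i≤ℓ) (λ _ → lev≤ℓ t v)
          ; par-edge  = edge′
          ; par-lev   = par-lev′
          ; par-rank  = par-rank′
          }

      -- Vertices of the path that are already attached keep their parents, so no cycle arises; each
      -- other vertex is attached to its predecessor on the path.
      attach-path : (t : Tree i) {u w : Fin n} → 1 ℕ.≤ lev t u → Star (Edge (E i)) u w →
                    ∃ λ (t′ : Tree i) → t ⊑ t′ × 1 ℕ.≤ lev t′ w
      attach-path t 1≤u ε = t , (λ _ → ℕ.≤-refl) , 1≤u
      attach-path t 1≤u (_◅_ {j = v} uv path) with 1 ℕ.≤? lev t v
      ... | yes 1≤v = attach-path t 1≤v path
      ... | no  1≰v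
        with t₁ , t⊑t₁ , 1≤v ← attach t 1≤u 1≰v uv
        with t₂ , t₁⊑t₂ , 1≤w ← attach-path t₁ 1≤v path
        = t₂ , (λ v → ℕ.≤-trans (t⊑t₁ v) (t₁⊑t₂ v)) , 1≤w

      -- The family `g` is there for the recursion; it is finally taken to be `id`, which treats all
      -- vertices.
      attach-all : s ∈ T i → (t : Tree i) → ∀ {m} (g : Fin m → Fin n) →
                   ∃ λ (t′ : Tree i) → t ⊑ t′ × (∀ j → g j ∈ T i → 1 ℕ.≤ lev t′ (g j))
      attach-all s∈T t {zero}  g = t , (λ _ → ℕ.≤-refl) , λ ()
      attach-all s∈T t {suc m} g
        with t₁ , t⊑t₁ , tail-attached ← attach-all s∈T t (g ∘ suc)
        with g zero ∈? T i
      ... | no  g₀∉T = t₁ , t⊑t₁ , λ { zero g₀∈T → contradiction g₀∈T g₀∉T ; (suc j) → tail-attached j }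
      ... | yes g₀∈T
        with t₂ , t₁⊑t₂ , 1≤g₀ ← attach-path t₁ (subst (1 ℕ.≤_) (sym (lev-root t₁)) 1≤ℓ) (spans 1≤i i≤ℓ s∈T g₀∈T)
        = t₂ , (λ v → ℕ.≤-trans (t⊑t₁ v) (t₁⊑t₂ v)) ,
          λ { zero _ → 1≤g₀ ; (suc j) gⱼ∈T → ℕ.≤-trans (tail-attached j gⱼ∈T) (t₁⊑t₂ _) }

    -- The strict `i < j` makes the property vacuous at `ℓ`, where the growth starts, and complete
    -- at 0, where it ends.
    Covers : ∀ {i} → Tree i → ℕ → Set
    Covers t i = ∀ {j v} → i ℕ.< j → j ℕ.≤ ℓ → v ∈ T j → j ℕ.≤ lev t v

    -- The stage for level `suc i` attaches its terminals at level at least `suc i` by `lev-lower`;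
    -- terminals of higher levels keep their levels by `⊑`.
    covering-tree : s ∈ T ℓ → ∀ {i} → i ≤‴ ℓ → ∃ λ (t : Tree i) → Covers t i
    covering-tree s∈T (≤‴-reflexive refl) = root-tree , λ ℓ<j j≤ℓ → contradiction j≤ℓ (ℕ.<⇒≱ ℓ<j)
    covering-tree s∈T {i} (≤‴-step i<ℓ)
      with t , covers ← covering-tree s∈T i<ℓ
      with t′ , t⊑t′ , attached ← attach-all (s≤s z≤n) (ℕ.≤‴⇒≤ i<ℓ)
        (T-antitone (s≤s z≤n) (ℕ.≤‴⇒≤ i<ℓ) ℕ.≤-refl s∈T) t id
      = lower t′ , covers′
      where
      covers′ : Covers (lower t′) i
      covers′ {j} {v} i<j j≤ℓ v∈T with suc i ℕ.≟ j
      ... | yes refl  = lev-lower t′ (attached v v∈T)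
      ... | no  1+i≢j = ℕ.≤-trans (covers (ℕ.≤∧≢⇒< i<j 1+i≢j) j≤ℓ v∈T) (t⊑t′ v)

    -- The feasible point given by a covering tree

    module TreeSolution (s∈T : s ∈ T ℓ) (t : Tree 0) (covers : Covers t 0) where
      open Tree t using () renaming (par to parent; lev to level; rank to depth)

      edge-below : ∀ {u v i j} → 1 ℕ.≤ i → i ℕ.≤ j → j ℕ.≤ ℓ → Edge (E j) u v → Edge (E i) u v
      edge-below {u} {v} = antitone {P = λ i → Edge (E i) u v} λ 1≤i i<ℓ → nested 1≤i i<ℓ

      -- `parent` is meaningful only at attached vertices other than `s`.
      Arc : Fin n → Fin n → Set
      Arc u v = v ≢ s × 1 ℕ.≤ level v × u ≡ parent v

      arc? : ∀ u v → Dec (Arc u v)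
      arc? u v = ¬? (v Fin.≟ s) ×-dec (1 ℕ.≤? level v) ×-dec (u Fin.≟ parent v)

      arc-edge : ∀ {u v} → Arc u v → Edge (E (level v)) u v
      arc-edge (v≢s , 1≤v , refl) = par-edge t v≢s 1≤v

      arc⇒Adj : ∀ {u v} → Arc u v → Adj u v
      arc⇒Adj {v = v} uv = ⊆Adj (E (level v)) (arc-edge uv)

      arc-level : ∀ {u v} → Arc u v → level v ℕ.≤ level u
      arc-level (v≢s , 1≤v , refl) = par-lev t v≢s 1≤v

      arc-depth : ∀ {u v} → Arc u v → depth u ℕ.< depth v
      arc-depth (v≢s , 1≤v , refl) = par-rank t v≢s 1≤v

      -- Common form of `x`, with `h` constantly 1, and of `y`, with `h` the level.
      onArcs : (Fin n → ℕ) → Fin n → Fin n → ℤ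
      onArcs h u v = if does (arc? u v) then + h v else 0ℤ

      0≤onArcs : ∀ h u v → 0ℤ ℤ.≤ onArcs h u v
      0≤onArcs h u v = if-elim (arc? u v) (0ℤ ℤ.≤_) (λ _ → +≤+ z≤n) (λ _ → ℤ.≤-refl)

      onArcs-incoming : ∀ h {p} {P : Fin n → Set p} {v k} (P? : Decidable P) →
                        Arc (parent v) v → P (parent v) → k ℕ.≤ h v →
                        + k ℤ.≤ ℤΣ.sum (λ u → if does (P? u) then onArcs h u v else 0ℤ)
      onArcs-incoming h {v = v} {k} P? arc Pu k≤h = ℤ.≤-trans
        (ℤ.≤-trans (+≤+ k≤h)
          (ℤ.≤-reflexive (sym (trans (if-yes (P? (parent v)) Pu) (if-yes (arc? (parent v) v) arc)))))
        (ℤΣ.term≤sum (λ u → if-elim (P? u) (0ℤ ℤ.≤_) (λ _ → 0≤onArcs h u v) (λ _ → ℤ.≤-refl)) (parent v))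

      -- If `v` has an arc to `w`, then `v` is attached and has an arc from its own parent. That
      -- parent is not the omitted `w`, because depth increases strictly along arcs.
      onArcs-conserved : ∀ h → (∀ {u v} → Arc u v → h v ℕ.≤ h u) → ∀ {v w} → v ≢ s →
                         onArcs h v w ℤ.≤ ∑N∖ I v w (λ u → onArcs h u v)
      onArcs-conserved h decreasing {v} {w} v≢s = if-elim (arc? v w) (ℤ._≤ ∑N∖ I v w (λ u → onArcs h u v))
        (λ vw → let arc = v≢s , ℕ.≤-trans (proj₁ (proj₂ vw)) (arc-level vw) , refl in
          onArcs-incoming h (λ u → adj? u v ×-dec ¬? (u Fin.≟ w)) arc
            (arc⇒Adj arc , λ par≡w →
              ℕ.<-asym (arc-depth vw) (subst (λ u → depth u ℕ.< depth v) par≡w (arc-depth arc)))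
            (decreasing vw))
        (λ _ → ℤΣ.sum-nonneg λ u →
          if-elim (adj? u v ×-dec ¬? (u Fin.≟ w)) (0ℤ ℤ.≤_) (λ _ → 0≤onArcs h u v) (λ _ → ℤ.≤-refl))

      divergence : (Fin n → Fin n → ℤ) → Fin n → ℤ
      divergence g v = ℤΣ.sum (λ w → g v w ℤ.- g w v)

      indicator : Fin n → Fin n → ℤ
      indicator u v = if does (v Fin.≟ u) then 1ℤ else 0ℤ

      single : Fin n → Fin n → Fin n → Fin n → ℤ
      single a b u v = if does (u Fin.≟ a) then indicator b v else 0ℤ

      divergence-single : ∀ a b v → divergence (single a b) v ≡ indicator a v ℤ.- indicator b v
      divergence-single a b v = trans (sum-minus (single a b v) (λ w → single a b w v)) (cong₂ ℤ._-_
        (if-elim (v Fin.≟ a) (λ z → ℤΣ.sum (single a b v) ≡ z)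
          (λ { refl → trans (ℤΣ.sum-cong {h = indicator b} λ w → if-yes (v Fin.≟ v) refl) (ℤΣ.sum-indicator b 1ℤ) })
          (λ v≢a → ℤΣ.sum-zero {g = single a b v} λ w → if-no (v Fin.≟ a) v≢a))
        (ℤΣ.sum-indicator a (indicator b v)))

      -- The unit flow along the tree path from s to v, with depth v as fuel.
      pathFlow : ℕ → Fin n → Fin n → Fin n → ℤ
      pathFlow zero    v a b = 0ℤ
      pathFlow (suc k) v a b =
        if does (v Fin.≟ s) then 0ℤ else single (parent v) v a b ℤ.+ pathFlow k (parent v) a b

      0≤single : ∀ a b u v → 0ℤ ℤ.≤ single a b u v
      0≤single a b u v = if-elim (u Fin.≟ a) (0ℤ ℤ.≤_)
        (λ _ → if-elim (v Fin.≟ b) (0ℤ ℤ.≤_) (λ _ → +≤+ z≤n) (λ _ → ℤ.≤-refl)) (λ _ → ℤ.≤-refl)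

      0≤pathFlow : ∀ k v a b → 0ℤ ℤ.≤ pathFlow k v a b
      0≤pathFlow zero    v a b = ℤ.≤-refl
      0≤pathFlow (suc k) v a b = if-elim (v Fin.≟ s) (0ℤ ℤ.≤_) (λ _ → ℤ.≤-refl)
        (λ _ → ℤ.+-mono-≤ (0≤single (parent v) v a b) (0≤pathFlow k (parent v) a b))

      pathFlow-root : ∀ k a b → pathFlow k s a b ≡ 0ℤ
      pathFlow-root zero    a b = refl
      pathFlow-root (suc k) a b = if-yes (s Fin.≟ s) refl

      parent-attached : ∀ {v} → v ≢ s → 1 ℕ.≤ level v → 1 ℕ.≤ level (parent v)
      parent-attached v≢s 1≤v = ℕ.≤-trans 1≤v (par-lev t v≢s 1≤v)

      -- The tree path to `v` only enters vertices at most as deep as `v`.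
      pathFlow-deeper : ∀ k v a b → 1 ℕ.≤ level v → depth v ℕ.< depth b → pathFlow k v a b ≡ 0ℤ
      pathFlow-deeper zero    v a b 1≤v v<b = refl
      pathFlow-deeper (suc k) v a b 1≤v v<b = if-elim (v Fin.≟ s) (_≡ 0ℤ) (λ _ → refl) λ v≢s →
        cong₂ ℤ._+_
          (if-elim (a Fin.≟ parent v) (_≡ 0ℤ)
            (λ _ → if-no (b Fin.≟ v) λ { refl → ℕ.<-irrefl refl v<b }) (λ _ → refl))
          (pathFlow-deeper k (parent v) a b (parent-attached v≢s 1≤v) (ℕ.<-trans (par-rank t v≢s 1≤v) v<b))

      -- The path uses no arc twice: after its last arc is removed, the rest ends at the parent and
      -- by `pathFlow-deeper` cannot enter `v` again.
      pathFlow≤onArcs : ∀ k v a b → 1 ℕ.≤ level v → pathFlow k v a b ℤ.≤ onArcs (const 1) a b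
      pathFlow≤onArcs zero    v a b 1≤v = 0≤onArcs (const 1) a b
      pathFlow≤onArcs (suc k) v a b 1≤v with v Fin.≟ s
      ... | yes _ = 0≤onArcs (const 1) a b
      ... | no v≢s with a Fin.≟ parent v | b Fin.≟ v
      ...   | no _     | _        = subst (ℤ._≤ onArcs (const 1) a b) (sym (ℤ.+-identityˡ _))
                                      (pathFlow≤onArcs k (parent v) a b (parent-attached v≢s 1≤v))
      ...   | yes _    | no _     = subst (ℤ._≤ onArcs (const 1) a b) (sym (ℤ.+-identityˡ _))
                                      (pathFlow≤onArcs k (parent v) a b (parent-attached v≢s 1≤v))
      ...   | yes refl | yes refl = ℤ.≤-reflexive (trans
        (cong (λ z → 1ℤ ℤ.+ z) (pathFlow-deeper k a a b (parent-attached v≢s 1≤v) (par-rank t v≢s 1≤v)))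
        (sym (if-yes (arc? a b) (v≢s , 1≤v , refl))))

      -- The divergences of the single arcs telescope. Fuel of at least `depth v` suffices, as each
      -- step to the parent lowers the depth.
      divergence-pathFlow : ∀ k v w → 1 ℕ.≤ level v → depth v ℕ.≤ k →
                            divergence (pathFlow k v) w ≡ indicator s w ℤ.- indicator v w
      divergence-pathFlow k v w 1≤v v≤k with v Fin.≟ s
      divergence-pathFlow k v w 1≤v v≤k | yes refl = trans
        (ℤΣ.sum-zero {g = λ u → pathFlow k s w u ℤ.- pathFlow k s u w} λ u →
          cong₂ ℤ._-_ (pathFlow-root k w u) (pathFlow-root k u w))
        (sym (ℤ.+-inverseʳ (indicator s w)))
      divergence-pathFlow zero v w 1≤v v≤0 | no v≢s =
        contradiction (ℕ.≤-trans (par-rank t v≢s 1≤v) v≤0) λ ()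
      divergence-pathFlow (suc k) v w 1≤v v≤k | no v≢s = begin
        divergence (pathFlow (suc k) v) w
          ≡⟨ ℤΣ.sum-cong (λ u → trans
               (cong₂ ℤ._-_ (if-no (v Fin.≟ s) v≢s) (if-no (v Fin.≟ s) v≢s))
               (solve 4 (λ a b c d → (a :+ b) :- (c :+ d) := (a :- c) :+ (b :- d)) refl
                 (single p v w u) (pathFlow k p w u) (single p v u w) (pathFlow k p u w))) ⟩
        ℤΣ.sum (λ u → (single p v w u ℤ.- single p v u w) ℤ.+ (pathFlow k p w u ℤ.- pathFlow k p u w))
          ≡⟨ ℤΣ.∑-distrib-+ (λ u → single p v w u ℤ.- single p v u w) (λ u → pathFlow k p w u ℤ.- pathFlow k p u w) ⟩
        divergence (single p v) w ℤ.+ divergence (pathFlow k p) w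
          ≡⟨ cong₂ ℤ._+_ (divergence-single p v w)
               (divergence-pathFlow k p w (parent-attached v≢s 1≤v)
                 (ℕ.≤-pred (ℕ.≤-trans (par-rank t v≢s 1≤v) v≤k))) ⟩
        (indicator p w ℤ.- indicator v w) ℤ.+ (indicator s w ℤ.- indicator p w)
          ≡⟨ solve 3 (λ a b c → (a :- b) :+ (c :- a) := c :- b) refl
               (indicator p w) (indicator v w) (indicator s w) ⟩
        indicator s w ℤ.- indicator v w ∎
        where
        open ≡-Reasoning
        open +-*-Solver using (solve; _:+_; _:-_; _:=_)
        p : Fin n
        p = parent v

      terminal-attached : ∀ {v} → v ∈ T 1 → 1 ℕ.≤ level v
      terminal-attached = covers (s≤s z≤n) 1≤ℓ

      s∈T₁ : s ∈ T 1
      s∈T₁ = T-antitone ℕ.≤-refl 1≤ℓ ℕ.≤-refl s∈T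

      terminalFlow : Fin n → Fin n → Fin n → ℤ
      terminalFlow v a b = if does (v ∈? T 1) then pathFlow (depth v) v a b else 0ℤ

      totalFlow : Fin n → Fin n → ℤ
      totalFlow a b = ℤΣ.sum (λ v → terminalFlow v a b)

      0≤totalFlow : ∀ a b → 0ℤ ℤ.≤ totalFlow a b
      0≤totalFlow a b = ℤΣ.sum-nonneg λ v →
        if-elim (v ∈? T 1) (0ℤ ℤ.≤_) (λ _ → 0≤pathFlow (depth v) v a b) (λ _ → ℤ.≤-refl)

      terminalFlow≤onArcs : ∀ v a b → terminalFlow v a b ℤ.≤ onArcs (const 1) a b
      terminalFlow≤onArcs v a b = if-elim (v ∈? T 1) (ℤ._≤ onArcs (const 1) a b)
        (λ v∈T → pathFlow≤onArcs (depth v) v a b (terminal-attached v∈T)) (λ _ → 0≤onArcs (const 1) a b)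

      sum-nonroot-terminals : ℤΣ.sum (λ v → (if does (v ∈? T 1) then 1ℤ else 0ℤ) ℤ.- indicator s v) ≡ ∣T₁∣-1 I
      sum-nonroot-terminals = trans (sum-minus (λ v → if does (v ∈? T 1) then 1ℤ else 0ℤ) (indicator s))
        (cong₂ ℤ._-_ (sum-membership (T 1)) (ℤΣ.sum-indicator s 1ℤ))

      -- Each terminal sends at most one unit over an arc and `s` sends none to itself, which
      -- accounts for the 1 subtracted from the number of terminals.
      totalFlow-capacity : ∀ a b → totalFlow a b ℤ.≤ ∣T₁∣-1 I ℤ.* onArcs (const 1) a b
      totalFlow-capacity a b = if-elim (arc? a b)
        -- The motive includes the bound on every terminal flow, so that the bound specialises to 1
        -- or 0 together with the capacity.
        (λ x → (∀ v → terminalFlow v a b ℤ.≤ x) → totalFlow a b ℤ.≤ ∣T₁∣-1 I ℤ.* x)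
        (λ _ flow≤1 → ℤ.≤-trans (ℤΣ.sum-mono (nonroot flow≤1))
          (ℤ.≤-reflexive (trans sum-nonroot-terminals (sym (ℤ.*-identityʳ (∣T₁∣-1 I))))))
        (λ _ flow≤0 → ℤ.≤-trans (ℤΣ.sum-mono flow≤0)
          (ℤ.≤-reflexive (trans (ℤΣ.sum-zero {n} λ _ → refl) (sym (ℤ.*-zeroʳ (∣T₁∣-1 I))))))
        (λ v → terminalFlow≤onArcs v a b)
        where
        nonroot : (∀ v → terminalFlow v a b ℤ.≤ 1ℤ) →
                  ∀ v → terminalFlow v a b ℤ.≤ (if does (v ∈? T 1) then 1ℤ else 0ℤ) ℤ.- indicator s v
        nonroot flow≤1 v with v Fin.≟ s
        ... | yes refl = ℤ.≤-reflexive (trans (if-yes (s ∈? T 1) s∈T₁) (trans (pathFlow-root (depth s) a b)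
          (sym (cong (λ z → z ℤ.- 1ℤ) (if-yes (s ∈? T 1) s∈T₁)))))
        ... | no v≢s with v ∈? T 1 | flow≤1 v
        ...   | yes _ | flow≤1 = flow≤1
        ...   | no  _ | _      = ℤ.≤-refl

      totalFlow-off-arcs : ∀ a b → ¬ Arc a b → totalFlow a b ≡ 0ℤ
      totalFlow-off-arcs a b ¬ab = ℤ.≤-antisym
        (ℤ.≤-trans (totalFlow-capacity a b) (ℤ.≤-reflexive
          (trans (cong (λ z → ∣T₁∣-1 I ℤ.* z) (if-no (arc? a b) ¬ab)) (ℤ.*-zeroʳ (∣T₁∣-1 I)))))
        (0≤totalFlow a b)

      divergence-terminalFlow : ∀ v w → divergence (terminalFlow v) w ≡
        (if does (v ∈? T 1) then indicator s w else 0ℤ) ℤ.- (if does (v ∈? T 1) then indicator v w else 0ℤ)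
      divergence-terminalFlow v w with v ∈? T 1
      ... | yes v∈T = divergence-pathFlow (depth v) v w (terminal-attached v∈T) ℕ.≤-refl
      ... | no  _   = ℤΣ.sum-zero {n} λ _ → refl

      -- After the sums are exchanged, every terminal contributes one unit produced at `s` and one
      -- unit consumed at itself; at `s` the two partly cancel.
      divergence-totalFlow : ∀ w → divergence totalFlow w ≡ supply I s w
      divergence-totalFlow w = begin
        ℤΣ.sum (λ u → totalFlow w u ℤ.- totalFlow u w)
          ≡⟨ ℤΣ.sum-cong (λ u → sym (sum-minus (λ v → terminalFlow v w u) (λ v → terminalFlow v u w))) ⟩
        ℤΣ.sum (λ u → ℤΣ.sum (λ v → terminalFlow v w u ℤ.- terminalFlow v u w))
          ≡⟨ ℤΣ.∑-comm (λ u v → terminalFlow v w u ℤ.- terminalFlow v u w) ⟩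
        ℤΣ.sum (λ v → divergence (terminalFlow v) w)
          ≡⟨ ℤΣ.sum-cong (λ v → divergence-terminalFlow v w) ⟩
        ℤΣ.sum (λ v → produced v ℤ.- consumed v)
          ≡⟨ sum-minus produced consumed ⟩
        ℤΣ.sum produced ℤ.- ℤΣ.sum consumed
          ≡⟨ cong (λ z → ℤΣ.sum produced ℤ.- z) (trans
               (ℤΣ.sum-single w λ v v≢w → if-elim (v ∈? T 1) (_≡ 0ℤ) (λ _ → if-no (w Fin.≟ v) (v≢w ∘ sym)) (λ _ → refl))
               (cong (λ z → if does (w ∈? T 1) then z else 0ℤ) (if-yes (w Fin.≟ w) refl))) ⟩
        ℤΣ.sum produced ℤ.- (if does (w ∈? T 1) then 1ℤ else 0ℤ)
          ≡⟨ balance ⟩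
        supply I s w ∎
        where
        open ≡-Reasoning
        produced consumed : Fin n → ℤ
        produced v = if does (v ∈? T 1) then indicator s w else 0ℤ
        consumed v = if does (v ∈? T 1) then indicator v w else 0ℤ

        balance : ℤΣ.sum produced ℤ.- (if does (w ∈? T 1) then 1ℤ else 0ℤ) ≡ supply I s w
        balance with w Fin.≟ s
        ... | yes refl = cong₂ ℤ._-_ (sum-membership (T 1)) (if-yes (w ∈? T 1) s∈T₁)
        ... | no  _    = trans
          (cong (λ z → z ℤ.- (if does (w ∈? T 1) then 1ℤ else 0ℤ))
            (ℤΣ.sum-zero {n} λ v → if-elim (v ∈? T 1) (_≡ 0ℤ) (λ _ → refl) (λ _ → refl)))
          (if-elim (w ∈? T 1) (λ z → 0ℤ ℤ.- z ≡ (if does (w ∈? T 1) then -1ℤ else 0ℤ))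
            (λ w∈T → sym (if-yes (w ∈? T 1) w∈T)) (λ w∉T → sym (if-no (w ∈? T 1) w∉T)))

      solution : Variables n
      solution = record { x = onArcs (const 1) ; y = onArcs level ; f = totalFlow }

      solution-feasible : IsFeasible I s solution
      solution-feasible = record
        -- `divergence` sums over all vertices; the restriction to neighbours changes nothing,
        -- because the flow vanishes off the arcs.
        { flow       = λ v → trans
            (cong₂ ℤ._-_
              (ℤΣ.sum-cong λ w → if-elim (adj? v w) (_≡ totalFlow v w) (λ _ → refl)
                λ ¬vw → sym (totalFlow-off-arcs v w (¬vw ∘ arc⇒Adj)))
              (ℤΣ.sum-cong λ u → if-elim (adj? u v) (_≡ totalFlow u v) (λ _ → refl)
                λ ¬uv → sym (totalFlow-off-arcs u v (¬uv ∘ arc⇒Adj))))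
            (trans (sym (sum-minus (totalFlow v) (λ u → totalFlow u v))) (divergence-totalFlow v))
        ; f≥0        = λ {u} {v} _ → 0≤totalFlow u v
        ; f-capacity = λ {u} {v} _ → totalFlow-capacity u v
        -- Only the arc from `parent v` can enter `v`.
        ; indegree   = λ v → ℤ.≤-trans
            (ℤΣ.sum-mono λ u → if-elim (u Fin.≟ parent v)
              ((if does (adj? u v) then onArcs (const 1) u v else 0ℤ) ℤ.≤_)
              (λ _ → if-elim (adj? u v) (ℤ._≤ 1ℤ) (λ _ → onArcs≤1 u v) (λ _ → +≤+ z≤n))
              (λ u≢par → if-elim (adj? u v) (ℤ._≤ 0ℤ)
                (λ _ → ℤ.≤-reflexive (if-no (arc? u v) (u≢par ∘ proj₂ ∘ proj₂))) (λ _ → ℤ.≤-refl)))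
            (ℤ.≤-reflexive (ℤΣ.sum-indicator (parent v) 1ℤ))
        ; x≤y        = λ {u} {v} _ → x≤y u v
        ; y≤ℓx       = λ {u} {v} _ → y≤ℓx u v
        ; x-incoming = λ _ → onArcs-conserved (const 1) (λ _ → ℕ.≤-refl)
        ; y-incoming = λ _ → onArcs-conserved level arc-level
        ; y-terminal = λ {v} v∈T v≢s → let arc = v≢s , terminal-attached v∈T , refl in
            onArcs-incoming level (λ u → adj? u v) arc (arc⇒Adj arc) (highestUpTo-least ℓ (level v) covers)
        ; x≥0        = λ {u} {v} _ → 0≤onArcs (const 1) u v
        ; x≤1        = λ {u} {v} _ → onArcs≤1 u v
        }
        where
        onArcs≤1 : ∀ u v → onArcs (const 1) u v ℤ.≤ 1ℤ
        onArcs≤1 u v = if-elim (arc? u v) (ℤ._≤ 1ℤ) (λ _ → ℤ.≤-refl) (λ _ → +≤+ z≤n)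

        x≤y : ∀ u v → onArcs (const 1) u v ℤ.≤ onArcs level u v
        x≤y u v = if-elim (arc? u v) (ℤ._≤ onArcs level u v)
          (λ arc → subst (1ℤ ℤ.≤_) (sym (if-yes (arc? u v) arc)) (+≤+ (proj₁ (proj₂ arc))))
          (λ _ → 0≤onArcs level u v)

        y≤ℓx : ∀ u v → onArcs level u v ℤ.≤ + ℓ ℤ.* onArcs (const 1) u v
        y≤ℓx u v = if-elim (arc? u v) (ℤ._≤ + ℓ ℤ.* onArcs (const 1) u v)
          (λ arc → subst (λ x → + level v ℤ.≤ + ℓ ℤ.* x) (sym (if-yes (arc? u v) arc))
            (subst (+ level v ℤ.≤_) (sym (ℤ.*-identityʳ (+ ℓ))) (+≤+ (lev≤ℓ t v))))
          (λ ¬arc → subst (λ x → 0ℤ ℤ.≤ + ℓ ℤ.* x) (sym (if-no (arc? u v) ¬arc))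
            (ℤ.≤-reflexive (sym (ℤ.*-zeroʳ (+ ℓ)))))

      -- The tree is acyclic, so at most one orientation of an edge is an arc.
      solution-multiplicity : ∀ u v → ∃ λ k → onArcs level u v ℤ.+ onArcs level v u ≡ + k × k ℕ.≤ ℓ ×
                              (∀ {i} → i ℕ.< k → Edge (E (suc i)) u v)
      solution-multiplicity u v with arcs u v | arcs v u
        where
        arcs : ∀ u v → (Arc u v × onArcs level u v ≡ + level v) ⊎ onArcs level u v ≡ 0ℤ
        arcs u v with arc? u v
        ... | yes uv = inj₁ (uv , if-yes (arc? u v) uv)
        ... | no ¬uv = inj₂ (if-no (arc? u v) ¬uv)
      ... | inj₁ (uv , _)      | inj₁ (vu , _)      = contradiction (arc-depth vu) (ℕ.<-asym (arc-depth uv))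
      ... | inj₁ (uv , uv≡lev) | inj₂ vu≡0          =
        level v , trans (cong₂ ℤ._+_ uv≡lev vu≡0) (ℤ.+-identityʳ _) , lev≤ℓ t v ,
        λ i<lev → edge-below (s≤s z≤n) i<lev (lev≤ℓ t v) (arc-edge uv)
      ... | inj₂ uv≡0          | inj₁ (vu , vu≡lev) =
        level u , trans (cong₂ ℤ._+_ uv≡0 vu≡lev) (ℤ.+-identityˡ _) , lev≤ℓ t u ,
        λ i<lev → symmetric (E _) (edge-below (s≤s z≤n) i<lev (lev≤ℓ t u) (arc-edge vu))
      ... | inj₂ uv≡0          | inj₂ vu≡0          = 0 , cong₂ ℤ._+_ uv≡0 vu≡0 , z≤n , λ ()

  -- Comparing the cost with the objective

  module _ where
    open OrderedAbelianGroup K using (Carrier; _≈_; _≤_; 0#; _·_)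
    open Variables
    private module KΣ = OrderedSums K

    0≤c : ∀ {u v} → Adj u v → 0# ≤ c u v
    0≤c uv = proj₁ (c-positive uv)

    counted? : (E : ℕ → EdgeSet graph) (u v : Fin n) →
               Decidable λ (i : Fin ℓ) → u Fin.< v × EdgeSet.Edge (E (suc (toℕ i))) u v
    counted? E u v i = (u Fin.<? v) ×-dec EdgeSet.edge? (E (suc (toℕ i))) u v

    edgeCost : (ℕ → EdgeSet graph) → Fin n → Fin n → Carrier
    edgeCost E u v = KΣ.sum λ i → if does (counted? E u v i) then c u v else 0#

    -- The cost is summed level by level and the objective edge by edge; moving the sum over levels
    -- inside allows a comparison on each edge.
    cost-edgewise : ∀ E → cost I E ≈ KΣ.sum (λ u → KΣ.sum (edgeCost E u))
    cost-edgewise E = KΣ.Eq.trans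
      (KΣ.∑-comm λ i u → KΣ.sum λ v → if does (counted? E u v i) then c u v else 0#)
      (KΣ.sum-cong λ u → KΣ.∑-comm λ i v → if does (counted? E u v i) then c u v else 0#)

    cost≤objective : ∀ E z → (∀ {u v} → u Fin.< v → Adj u v → edgeCost E u v ≤ (y z u v ℤ.+ y z v u) · c u v) →
                     cost I E ≤ objective I z
    cost≤objective E z bound = KΣ.≤-trans (KΣ.≤-reflexive (cost-edgewise E)) (KΣ.sum-mono λ u → KΣ.sum-mono λ v →
      if-elim ((u Fin.<? v) ×-dec adj? u v) (edgeCost E u v ≤_) (λ (u<v , uv) → bound u<v uv)
        λ ¬uv → KΣ.≤-reflexive (KΣ.sum-zero λ i → KΣ.Eq.reflexive
          (if-no (counted? E u v i) λ (u<v , uv) → ¬uv (u<v , EdgeSet.⊆Adj (E (suc (toℕ i))) uv))))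

    objective≤cost : ∀ E z → (∀ {u v} → u Fin.< v → Adj u v → (y z u v ℤ.+ y z v u) · c u v ≤ edgeCost E u v) →
                     objective I z ≤ cost I E
    objective≤cost E z bound = KΣ.≤-trans
      (KΣ.sum-mono λ u → KΣ.sum-mono λ v →
        if-elim ((u Fin.<? v) ×-dec adj? u v) (_≤ edgeCost E u v) (λ (u<v , uv) → bound u<v uv)
          λ _ → KΣ.sum-nonneg λ i → if-elim (counted? E u v i) (0# ≤_)
            (λ (_ , uv) → 0≤c (EdgeSet.⊆Adj (E (suc (toℕ i))) uv)) (λ _ → KΣ.≤-refl))
      (KΣ.≤-reflexive (KΣ.Eq.sym (cost-edgewise E)))

    -- From the chain 0 ≤ `x` ≤ `y` ≤ `ℓ` times `x` ≤ `ℓ`.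
    y-multiplicity : ∀ {s z} → IsFeasible I s z → ∀ {u v} → Adj u v → ∃ λ k → y z u v ≡ + k × k ℕ.≤ ℓ
    y-multiplicity {z = z} feasible {u} {v} uv =
      natural (ℤ.≤-trans (x≥0 uv) (x≤y uv)) (ℤ.≤-trans (y≤ℓx uv)
        (subst (+ ℓ ℤ.* x z u v ℤ.≤_) (ℤ.*-identityʳ (+ ℓ)) (ℤ.*-monoˡ-≤-nonNeg (+ ℓ) (x≤1 uv))))
      where
      open IsFeasible feasible
      natural : ∀ {i} → 0ℤ ℤ.≤ i → i ℤ.≤ + ℓ → ∃ λ k → i ≡ + k × k ℕ.≤ ℓ
      natural (+≤+ _) (+≤+ k≤ℓ) = _ , refl , k≤ℓ

    levelEdges-cost≤objective : ∀ {s z} → IsFeasible I s z → cost I (levelEdges I z) ≤ objective I z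
    levelEdges-cost≤objective {z = z} feasible = cost≤objective (levelEdges I z) z bound
      where
      bound : ∀ {u v} → u Fin.< v → Adj u v → edgeCost (levelEdges I z) u v ≤ (y z u v ℤ.+ y z v u) · c u v
      bound {u} {v} u<v uv
        with k , y≡k , k≤ℓ ← y-multiplicity feasible uv
        with l , y≡l , l≤ℓ ← y-multiplicity feasible (symmetric uv)
        = subst₂ (λ p q → edgeCost (levelEdges I z) u v ≤ (p ℤ.+ q) · c u v) (sym y≡k) (sym y≡l)
            (KΣ.sum≤threshold+threshold (counted? (levelEdges I z) u v) (0≤c uv) k≤ℓ l≤ℓ
              -- Membership in level `suc (toℕ i)` through `y u v`, which is `k`, means `toℕ i < k`;
              -- likewise for `y v u` and `l`.
              λ i (_ , _ , i<y) → Sum.map (λ 1+i≤y → ℤ.drop‿+≤+ (subst (+ suc (toℕ i) ℤ.≤_) y≡k 1+i≤y))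
                                      (λ 1+i≤y → ℤ.drop‿+≤+ (subst (+ suc (toℕ i) ℤ.≤_) y≡l 1+i≤y)) i<y)

    cheap-solution : ∀ {s} → s ∈ T ℓ → ∀ E → IsMultiLevelSteinerTree I E →
                     ∃ λ z → IsFeasible I s z × objective I z ≤ cost I E
    cheap-solution {s} s∈T E mlst
      with t , covers ← covering-tree E mlst s s∈T (ℕ.≤⇒≤‴ z≤n)
      = solution , solution-feasible , objective≤cost E solution bound
      where
      open TreeSolution E mlst s s∈T t covers
      bound : ∀ {u v} → u Fin.< v → Adj u v →
              (y solution u v ℤ.+ y solution v u) · c u v ≤ edgeCost E u v
      bound {u} {v} u<v uv with k , y+y≡k , k≤ℓ , <k⇒edge ← solution-multiplicity u v =
        subst (λ p → p · c u v ≤ edgeCost E u v) (sym y+y≡k)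
          (KΣ.sum-threshold≤ (counted? E u v) (0≤c uv) k≤ℓ λ i i<k → u<v , <k⇒edge i<k)

theorem3p3 : ∀ {a ℓ₁ ℓ₂} (K : OrderedAbelianGroup a ℓ₁ ℓ₂) (n ℓ : ℕ)
    (I : Instance K n ℓ) (s : Fin n) → s ∈ Instance.T I ℓ →
    (z : Variables n) → IsOptimal I s z →
    IsOptimalMultiLevelSteinerTree I (levelEdges I z)
theorem3p3 K n ℓ I s s∈T z (feasible , optimal) =
  Feasible.levelEdges-isMultiLevelSteinerTree I z feasible , λ E mlst →
    let z′ , feasible′ , objective≤ = cheap-solution I s∈T E mlst in
    ≤-trans (levelEdges-cost≤objective I feasible) (≤-trans (optimal z′ feasible′) objective≤)
  where open OrderedSums K using (≤-trans)
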